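{- The homomorphism order $(\mathsf{DiCycles},\leq)$ on finite disjoint unions of directed cycles is universal.
   Context: $\overrightarrow{C}_k$ is the directed cycle on $k$ vertices with all edges oriented in the same direction. $\mathsf{DiCycles}$ is the class of directed graphs that are disjoint unions of finitely many directed cycles $\overrightarrow{C}_k$, $k\geq 3$. For directed graphs, $G\leq H$ means there is a homomorphism $G\to H$, i.e. a map $f:V_G\to V_H$ with $(f(u),f(v))\in E_H$ for every $(u,v)\in E_G$. This quasi-order is regarded as a partial order by identifying homomorphically equivalent graphs ($G\leq H\leq G$). A countable partial order is universal if every countable partial order $(P,\leq_P)$ embeds into it, i.e. there is a map $E$ with $a\leq_P b\iff E(a)\leq E(b)$ for all $a,b\in P$. -}

module Defs where

open import Data.Fin.Base using (Fin; toℕ)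
open import Data.Nat.Base using (ℕ; suc; _≤_)
open import Data.Product.Base using (Σ; Σ-syntax; ∃-syntax; _×_; _,_; proj₁)
open import Data.Sum.Base using (_⊎_)
open import Function.Base using (id; _∘_)
open import Function.Bundles using (_⇔_; _↔_; Inverse; Injection)
open import Level using (Level; 0ℓ; _⊔_) renaming (suc to lsuc)
open import Relation.Binary.Bundles using (Poset)
open import Relation.Binary.Core using (Rel)
open import Relation.Binary.PropositionalEquality using (_≡_; setoid)
import Relation.Binary.Construct.Interior.Symmetric as SymInterior

record Digraph : Set₁ where
  field
    V : Set
    E : Rel V 0ℓ

open Digraph public

infix 4 _⟶_ _≅_

record _⟶_ (G H : Digraph) : Set where
  field
    map  : V G → V H
    edge : ∀ {u v} → E G u v → E H (map u) (map v)

record _≅_ (G H : Digraph) : Set where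
  field
    bijection : V G ↔ V H
    edges     : ∀ u v → E G u v ⇔ E H (Inverse.to bijection u) (Inverse.to bijection v)

⟶-refl : ∀ {G} → G ⟶ G
⟶-refl = record { map = id ; edge = id }

⟶-trans : ∀ {G H K} → G ⟶ H → H ⟶ K → G ⟶ K
⟶-trans f g = record
  { map  = _⟶_.map g ∘ _⟶_.map f
  ; edge = _⟶_.edge g ∘ _⟶_.edge f
  }

-- The edges are 0 → 1 → ⋯ → k-1 → 0.
C : ℕ → Digraph
C k = record
  { V = Fin k
  ; E = λ i j → toℕ j ≡ suc (toℕ i) ⊎ (suc (toℕ i) ≡ k × toℕ j ≡ 0)
  }

data ⨆E {I : Set} (G : I → Digraph) : Rel (Σ[ i ∈ I ] V (G i)) 0ℓ where
  within : ∀ {i u v} → E (G i) u v → ⨆E G (i , u) (i , v)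

⨆ : {I : Set} → (I → Digraph) → Digraph
⨆ {I} G = record { V = Σ[ i ∈ I ] V (G i) ; E = ⨆E G }

-- The class is closed under isomorphism, and the union may be empty (n = 0).
IsDiCycles : Digraph → Set
IsDiCycles G =
  ∃[ n ] Σ[ k ∈ (Fin n → ℕ) ] (∀ i → 3 ≤ k i) × G ≅ ⨆ (λ i → C (k i))

DiCycles : Set₁
DiCycles = Σ Digraph IsDiCycles

-- Its equality is homomorphic equivalence.
DiCyclesOrder : Poset (lsuc 0ℓ) 0ℓ 0ℓ
DiCyclesOrder = SymInterior.poset {A = DiCycles} {R = λ G H → proj₁ G ⟶ proj₁ H}
  ⟶-refl ⟶-trans

private
  variable
    c ℓ₁ ℓ₂ c′ ℓ₁′ ℓ₂′ : Level

-- Finite or countably infinite.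
Countable : Poset c ℓ₁ ℓ₂ → Set (c ⊔ ℓ₁)
Countable P = Injection (Poset.Eq.setoid P) (setoid ℕ)

Embedding : Poset c ℓ₁ ℓ₂ → Poset c′ ℓ₁′ ℓ₂′ → Set (c ⊔ ℓ₂ ⊔ c′ ⊔ ℓ₂′)
Embedding P Q =
  Σ[ f ∈ (P.Carrier → Q.Carrier) ] (∀ a b → a P.≤ b ⇔ f a Q.≤ f b)
  where
  module P = Poset P
  module Q = Poset Q

-- The levels are those of the partial orders that are to be embedded.
Universal : ∀ c ℓ₁ ℓ₂ → Poset c′ ℓ₁′ ℓ₂′ → Set (lsuc (c ⊔ ℓ₁ ⊔ ℓ₂) ⊔ c′ ⊔ ℓ₁′ ⊔ ℓ₂′)
Universal c ℓ₁ ℓ₂ U =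
  Countable U × (∀ (P : Poset c ℓ₁ ℓ₂) → Countable P → Embedding P U)

{-# OPTIONS --safe #-}
-- A homomorphism C n → ⨆ C kⱼ exists iff some kⱼ divides n, so DiCycles is the
-- order on finite sets of integers ≥ 3 in which A ⊑ B iff every element of A is
-- a multiple of an element of B.  Coding finite sets of naturals by
-- least common multiples of pairwise coprime numbers turns inclusion into
-- divisibility.  Given a preorder ≼ on ℕ, let F v be the code of
-- { z ≤ v ∣ v ≼ z }; then v ↦ { F w ∣ w ≤ v , w ≼ v } embeds ≼ into DiCycles:
-- if w ≼ v, then either w ≤ v and F w occurs in the image of v, or v ≤ w and
-- F v divides F w.  The order is countable because a union of cycles is
-- determined up to equivalence by the least code of a list equivalent to it.
module Submission where

open import Defs
open import Axiom.ExcludedMiddle using (ExcludedMiddle)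
open import Level using (Level; _⊔_; lift; lower)
open import Data.Fin.Base using (Fin; toℕ)
open import Data.Fin.Properties using (toℕ-fromℕ<; toℕ-injective)
open import Data.List.Base using (List; []; _∷_; filter; length; lookup; map; tabulate; upTo)
open import Data.List.Membership.Propositional using (_∈_; find; lose)
open import Data.List.Membership.Propositional.Properties
  using (∈-filter⁺; ∈-filter⁻; ∈-map⁺; ∈-map⁻; ∈-upTo⁺; ∈-upTo⁻; ∈-lookup)
open import Data.List.Properties using (tabulate-lookup)
open import Data.List.Relation.Binary.Subset.Propositional using (_⊆_)
open import Data.List.Relation.Unary.All as All using (All)
import Data.List.Relation.Unary.All.Properties as All
open import Data.List.Relation.Unary.Any as Any using (Any; here; there)
import Data.List.Relation.Unary.Any.Properties as Any
open import Data.Nat.Base hiding (_⊔_)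
open import Data.Nat.Coprimality as Coprime using (Coprime; coprime-divisor)
open import Data.Nat.Divisibility
open import Data.Nat.DivMod
open import Data.Nat.GCD using (gcd)
open import Data.Nat.LCM
open import Data.Nat.Properties
open import Data.Product.Base using (∃-syntax; _×_; _,_; proj₁; proj₂)
open import Data.Sum.Base using (inj₁; inj₂)
open import Function.Base using (_∘_; id)
open import Function.Bundles using (_⇔_; mk⇔; Equivalence; Injection; Inverse)
open import Relation.Binary.Bundles using (Poset)
open import Relation.Binary.Core using (Rel)
open import Relation.Binary.Definitions using (Reflexive; Transitive; tri<; tri≈; tri>)
import Relation.Binary.Definitions as B
open import Relation.Binary.PropositionalEquality
open import Relation.Nullary using (yes; no; contradiction)
open import Relation.Nullary.Decidable using (map′)
open import Relation.Unary using (Pred; Decidable)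
import Relation.Binary.Construct.Interior.Symmetric as SymInterior
open SymInterior using (SymInterior; _,_; lhs≤rhs; rhs≤lhs)

private
  variable
    c ℓ ℓ₁ ℓ₂ : Level
    k m n : ℕ

-- Divisibility order on finite sets

infix 4 _⊑_

_⊑_ : Rel (List ℕ) _
xs ⊑ ys = All (λ x → Any (_∣ x) ys) xs

⊆⇒⊑ : ∀ {xs ys} → xs ⊆ ys → xs ⊑ ys
⊆⇒⊑ xs⊆ys = All.tabulate λ x∈xs → lose (xs⊆ys x∈xs) ∣-refl

⊑-refl : Reflexive _⊑_
⊑-refl = ⊆⇒⊑ id

⊑-trans : Transitive _⊑_
⊑-trans xs⊑ys ys⊑zs = All.map (λ any∣x →
  let _ , y∈ys , y∣x = find any∣x
  in Any.map (λ z∣y → ∣-trans z∣y y∣x) (All.lookup ys⊑zs y∈ys)) xs⊑ys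

-- Homomorphisms between unions of cycles

suc-% : ∀ n m .{{_ : NonZero m}} → suc n % m ≡ suc (n % m) % m
suc-% n m = trans (cong (λ x → suc x % m) (m≡m%n+[m/n]*n n m))
                  ([m+kn]%n≡m%n (suc (n % m)) (n / m) m)

-- The infinite walk around `C m`. It serves both to map into a cycle and to unroll a cycle that is
-- mapped elsewhere.
C-edge-mod : ∀ m n .{{_ : NonZero m}} → E (C m) (n mod m) (suc n mod m)
C-edge-mod m n
  rewrite toℕ-fromℕ< (m%n<n n m) | toℕ-fromℕ< (m%n<n (suc n) m)
  with suc (n % m) ≟ m
... | yes last = inj₂ (last , trans (suc-% n m) (trans (cong (_% m) last) (n%n≡0 m)))
... | no ¬last = inj₁ (trans (suc-% n m) (m<n⇒m%n≡m (≤∧≢⇒< (m%n<n n m) ¬last)))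

-- Divisibility matters only for the edge that closes `C n`: its target 0 has to agree with `n`
-- modulo `m`.
∣⇒C⟶C : ∀ m n .{{_ : NonZero m}} → m ∣ n → C n ⟶ C m
∣⇒C⟶C m n m∣n = record { map = λ u → toℕ u mod m ; edge = edge }
  where
  edge : ∀ {u v} → E (C n) u v → E (C m) (toℕ u mod m) (toℕ v mod m)
  edge {u} {v} (inj₁ v≡1+u) =
    subst (λ x → E (C m) (toℕ u mod m) (x mod m)) (sym v≡1+u) (C-edge-mod m (toℕ u))
  edge {u} {v} (inj₂ (1+u≡n , v≡0)) =
    subst (E (C m) (toℕ u mod m)) (toℕ-injective wrap) (C-edge-mod m (toℕ u))
    where
    open ≡-Reasoning
    wrap : toℕ (suc (toℕ u) mod m) ≡ toℕ (toℕ v mod m)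
    wrap = begin
      toℕ (suc (toℕ u) mod m)  ≡⟨ toℕ-fromℕ< _ ⟩
      suc (toℕ u) % m          ≡⟨ cong (_% m) 1+u≡n ⟩
      n % m                    ≡⟨ n∣m⇒m%n≡0 n m m∣n ⟩
      0                        ≡⟨ n∣m⇒m%n≡0 0 m (m ∣0) ⟨
      0 % m                    ≡⟨ cong (_% m) v≡0 ⟨
      toℕ v % m                ≡⟨ toℕ-fromℕ< _ ⟨
      toℕ (toℕ v mod m)        ∎

module _ {I : Set} (k : I → ℕ) where

  private
    length-of : V (⨆ (C ∘ k)) → ℕ
    length-of x = k (proj₁ x)

    position : V (⨆ (C ∘ k)) → ℕ
    position x = toℕ (proj₂ x)

  -- A walk never leaves its component. Each step adds 1 to the position unless it crosses the
  -- closing edge and resets the position to 0; `q` counts the resets.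
  walk-position : (s : ℕ → V (⨆ (C ∘ k))) → (∀ n → E (⨆ (C ∘ k)) (s n) (s (suc n))) →
                  ∀ n → ∃[ q ] position (s 0) + n ≡ position (s n) + q * length-of (s 0)
                               × length-of (s n) ≡ length-of (s 0)
  walk-position s step zero    = 0 , refl , refl
  walk-position s step (suc n)
    with walk-position s step n
  ... | q , eq , same
    rewrite +-suc (position (s 0)) n | eq
    with s n | s (suc n) | step n
  ... | _ | _ | within {u = u} {v} (inj₁ v≡1+u) rewrite v≡1+u = q , refl , same
  ... | _ | _ | within {u = u} {v} (inj₂ (1+u≡k , v≡0))
    rewrite v≡0 = suc q , cong (_+ q * length-of (s 0)) (trans 1+u≡k same) , same

  -- One turn around `C n` maps to a closed walk, so its two end positions cancel and `n` is the
  -- number of resets times the length.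
  C⟶⨆C⇒∣ : ∀ n .{{_ : NonZero n}} → C n ⟶ ⨆ (C ∘ k) → ∃[ j ] k j ∣ n
  C⟶⨆C⇒∣ n f = proj₁ (s 0) , divides q (+-cancelˡ-≡ (position (s 0)) _ _ (begin
    position (s 0) + n                     ≡⟨ eq ⟩
    position (s n) + q * length-of (s 0)   ≡⟨ cong (λ x → position x + q * length-of (s 0)) closed ⟩
    position (s 0) + q * length-of (s 0)   ∎))
    where
    open ≡-Reasoning
    s : ℕ → V (⨆ (C ∘ k))
    s i = _⟶_.map f (i mod n)
    closed : s n ≡ s 0
    closed = cong (_⟶_.map f) (toℕ-injective (begin
      toℕ (n mod n)  ≡⟨ toℕ-fromℕ< _ ⟩
      n % n          ≡⟨ n%n≡0 n ⟩
      0              ≡⟨ n∣m⇒m%n≡0 0 n (n ∣0) ⟨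
      0 % n          ≡⟨ toℕ-fromℕ< _ ⟨
      toℕ (0 mod n)  ∎))
    walk = walk-position s (λ i → _⟶_.edge f (C-edge-mod n i)) n
    q = proj₁ walk
    eq = proj₁ (proj₂ walk)

inject-⨆ : ∀ {I : Set} (G : I → Digraph) i → G i ⟶ ⨆ G
inject-⨆ G i = record { map = i ,_ ; edge = within }

[_]-⨆ : ∀ {I : Set} {G : I → Digraph} {H} → (∀ i → G i ⟶ H) → ⨆ G ⟶ H
[_]-⨆ {G = G} {H} f = record { map = λ (i , u) → _⟶_.map (f i) u ; edge = edge }
  where
  edge : ∀ {x y} → ⨆E G x y → E H (_⟶_.map (f (proj₁ x)) (proj₂ x)) (_⟶_.map (f (proj₁ y)) (proj₂ y))
  edge (within {i} e) = _⟶_.edge (f i) e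

3≤⇒nonZero : 3 ≤ n → NonZero n
3≤⇒nonZero 3≤n = >-nonZero (<-≤-trans z<s 3≤n)

⨆C⟶⨆C⇔⊑ : (k : Fin m → ℕ) (l : Fin n → ℕ) → (∀ i → 3 ≤ k i) → (∀ j → 3 ≤ l j) →
          ⨆ (C ∘ k) ⟶ ⨆ (C ∘ l) ⇔ tabulate k ⊑ tabulate l
⨆C⟶⨆C⇔⊑ k l 3≤k 3≤l = mk⇔ to from
  where
  to : ⨆ (C ∘ k) ⟶ ⨆ (C ∘ l) → tabulate k ⊑ tabulate l
  to f = All.tabulate⁺ λ i →
    let j , l∣k = C⟶⨆C⇒∣ l (k i) {{3≤⇒nonZero (3≤k i)}} (⟶-trans (inject-⨆ (C ∘ k) i) f)
    in Any.tabulate⁺ j l∣k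
  from : tabulate k ⊑ tabulate l → ⨆ (C ∘ k) ⟶ ⨆ (C ∘ l)
  from k⊑l = [ (λ i →
    let j , l∣k = Any.tabulate⁻ (All.tabulate⁻ k⊑l i)
    in ⟶-trans (∣⇒C⟶C (l j) (k i) {{3≤⇒nonZero (3≤l j)}} l∣k) (inject-⨆ (C ∘ l) j)) ]-⨆

module _ {G H : Digraph} (iso : G ≅ H) where
  open _≅_ iso
  open Inverse bijection using (to; from; strictlyInverseˡ)

  ≅⇒⟶ : G ⟶ H
  ≅⇒⟶ = record { map = to ; edge = Equivalence.to (edges _ _) }

  ≅⇒⟵ : H ⟶ G
  ≅⇒⟵ = record { map = from ; edge = λ {u} {v} e → Equivalence.from (edges _ _)
    (subst₂ (E H) (sym (strictlyInverseˡ u)) (sym (strictlyInverseˡ v)) e) }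

lengths : DiCycles → List ℕ
lengths (_ , _ , k , _) = tabulate k

⟶⇔lengths-⊑ : ∀ G H → proj₁ G ⟶ proj₁ H ⇔ lengths G ⊑ lengths H
⟶⇔lengths-⊑ (G , _ , k , 3≤k , G≅) (H , _ , l , 3≤l , H≅) = mk⇔
  (λ f → cycles.to (⟶-trans (≅⇒⟵ G≅) (⟶-trans f (≅⇒⟶ H≅))))
  (λ k⊑l → ⟶-trans (≅⇒⟶ G≅) (⟶-trans (cycles.from k⊑l) (≅⇒⟵ H≅)))
  where module cycles = Equivalence (⨆C⟶⨆C⇔⊑ k l 3≤k 3≤l)

≅-refl : ∀ {G} → G ≅ G
≅-refl = record
  { bijection = record
    { to = id ; from = id ; to-cong = id ; from-cong = id ; inverse = id , id }
  ; edges = λ _ _ → mk⇔ id id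
  }

cycles : (xs : List ℕ) → All (3 ≤_) xs → DiCycles
cycles xs 3≤xs =
  ⨆ (C ∘ lookup xs) , length xs , lookup xs , (λ i → All.lookup 3≤xs (∈-lookup i)) , ≅-refl

-- Coding finite sets by divisibility

-- The partial products 2, 6, 42, ... of Sylvester's sequence 2, 3, 7, 43, ..., whose term 2 is
-- skipped below so that every term is a legal cycle length.
sylvester-product : ℕ → ℕ
sylvester-product zero    = 2
sylvester-product (suc n) = sylvester-product n * suc (sylvester-product n)

sylvester : ℕ → ℕ
sylvester n = suc (sylvester-product n)

2≤sylvester-product : ∀ n → 2 ≤ sylvester-product n
2≤sylvester-product zero    = ≤-refl
2≤sylvester-product (suc n) = ≤-trans (2≤sylvester-product n) (m≤m*n _ _)

3≤sylvester : ∀ n → 3 ≤ sylvester n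
3≤sylvester n = s≤s (2≤sylvester-product n)

sylvester-∣-product : m <′ n → sylvester m ∣ sylvester-product n
sylvester-∣-product {m} ≤′-refl = n∣m*n (sylvester-product m)
sylvester-∣-product (≤′-step m<n) = ∣-trans (sylvester-∣-product m<n) (m∣m*n _)

-- The smaller term divides `sylvester-product n`, and the larger one is its successor, so a common
-- divisor divides 1.
sylvester-coprime-< : m < n → Coprime (sylvester m) (sylvester n)
sylvester-coprime-< {n = n} m<n {d} (d∣m , d∣n) = ∣1⇒≡1 (∣m+n∣m⇒∣n
  (subst (d ∣_) (+-comm 1 (sylvester-product n)) d∣n)
  (∣-trans d∣m (sylvester-∣-product (<⇒<′ m<n))))

sylvester-coprime : m ≢ n → Coprime (sylvester m) (sylvester n)
sylvester-coprime {m} {n} m≢n with <-cmp m n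
... | tri< m<n _ _ = sylvester-coprime-< m<n
... | tri≈ _ m≡n _ = contradiction m≡n m≢n
... | tri> _ _ n<m = Coprime.sym (sylvester-coprime-< n<m)

-- With `lcm` in place of the product, repeated entries do not change the code.
code : List ℕ → ℕ
code []       = 1
code (x ∷ xs) = lcm (sylvester x) (code xs)

∈⇒sylvester-∣-code : ∀ {xs} → n ∈ xs → sylvester n ∣ code xs
∈⇒sylvester-∣-code {n} {_ ∷ xs} (here refl)  = m∣lcm[m,n] (sylvester n) (code xs)
∈⇒sylvester-∣-code {n} {x ∷ xs} (there n∈xs) =
  ∣-trans (∈⇒sylvester-∣-code n∈xs) (n∣lcm[m,n] (sylvester x) (code xs))

sylvester-∣-code⇒∈ : ∀ xs → sylvester n ∣ code xs → n ∈ xs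
sylvester-∣-code⇒∈ {n} [] s∣1 =
  contradiction (∣1⇒≡1 s∣1) (>⇒≢ (<-≤-trans (s≤s (s≤s z≤n)) (3≤sylvester n)))
sylvester-∣-code⇒∈ {n} (x ∷ xs) s∣code with n ≟ x
... | yes n≡x = here n≡x
-- The lcm divides the product, whose first factor is coprime to `sylvester n`.
... | no  n≢x = there (sylvester-∣-code⇒∈ xs
  (coprime-divisor {n = sylvester x} (sylvester-coprime n≢x) (∣-trans s∣code
    (lcm-least {sylvester x} {code xs} (m∣m*n (code xs)) (n∣m*n (sylvester x))))))

code-least : ∀ {xs} → (∀ {n} → n ∈ xs → sylvester n ∣ m) → code xs ∣ m
code-least {m} {[]}     _   = 1∣ m
code-least {m} {x ∷ xs} s∣m = lcm-least (s∣m (here refl)) (code-least {xs = xs} (s∣m ∘ there))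

code-∣⇔⊆ : ∀ xs ys → code xs ∣ code ys ⇔ xs ⊆ ys
code-∣⇔⊆ xs ys = mk⇔
  (λ xs∣ys {n} n∈xs → sylvester-∣-code⇒∈ ys (∣-trans (∈⇒sylvester-∣-code n∈xs) xs∣ys))
  (λ xs⊆ys → code-least {xs = xs} (λ n∈xs → ∈⇒sylvester-∣-code (xs⊆ys n∈xs)))

code≢0 : ∀ xs → code xs ≢ 0
code≢0 (x ∷ xs) lcm≡0 = code≢0 xs (m*n≡0⇒m≡0 (code xs) (sylvester x) (begin
  code xs * sylvester x                                  ≡⟨ *-comm (code xs) _ ⟩
  sylvester x * code xs                                  ≡⟨ gcd*lcm (sylvester x) (code xs) ⟨
  gcd (sylvester x) (code xs) * lcm (sylvester x) (code xs)  ≡⟨ cong (gcd (sylvester x) (code xs) *_) lcm≡0 ⟩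
  gcd (sylvester x) (code xs) * 0                        ≡⟨ *-zeroʳ (gcd (sylvester x) (code xs)) ⟩
  0                                                      ∎))
  where open ≡-Reasoning

∈⇒3≤code : ∀ {xs} → n ∈ xs → 3 ≤ code xs
∈⇒3≤code {n} {xs} n∈xs =
  ≤-trans (3≤sylvester n) (∣⇒≤ {{≢-nonZero (code≢0 xs)}} (∈⇒sylvester-∣-code n∈xs))

-- Embedding a decidable preorder on the natural numbers

module _ {_≼_ : Rel ℕ ℓ} (≼-refl : Reflexive _≼_) (≼-trans : Transitive _≼_)
         (_≼?_ : B.Decidable _≼_) where

  above : ℕ → List ℕ
  above v = filter (v ≼?_) (upTo (suc v))

  below : ℕ → List ℕ
  below v = filter (_≼? v) (upTo (suc v))

  ∈-above⁺ : n ≤ m → m ≼ n → n ∈ above m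
  ∈-above⁺ {m = m} n≤m = ∈-filter⁺ (m ≼?_) (∈-upTo⁺ (s≤s n≤m))

  ∈-above⁻ : n ∈ above m → n ≤ m × m ≼ n
  ∈-above⁻ {m = m} n∈ = let n∈upTo , m≼n = ∈-filter⁻ (m ≼?_) n∈ in s≤s⁻¹ (∈-upTo⁻ n∈upTo) , m≼n

  -- By reflexivity `m` is in `above m`, hence in `above n`.
  code-above-∣⇒≼ : code (above m) ∣ code (above n) → n ≼ m
  code-above-∣⇒≼ {m} {n} m∣n =
    proj₂ (∈-above⁻ (Equivalence.to (code-∣⇔⊆ (above m) (above n)) m∣n (∈-above⁺ ≤-refl ≼-refl)))

  -- As `above n` is cut off at `n`, the bound `m ≤ n` ensures that it reaches all of `above m`.
  ≤∧≼⇒code-above-∣ : m ≤ n → n ≼ m → code (above m) ∣ code (above n)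
  ≤∧≼⇒code-above-∣ {m} {n} m≤n n≼m = Equivalence.from (code-∣⇔⊆ (above m) (above n)) λ z∈ →
    let z≤m , m≼z = ∈-above⁻ z∈ in ∈-above⁺ (≤-trans z≤m m≤n) (≼-trans n≼m m≼z)

  image : ℕ → List ℕ
  image v = map (code ∘ above) (below v)

  3≤image : ∀ v → All (3 ≤_) (image v)
  3≤image v = All.map⁺ (All.tabulate λ _ → ∈⇒3≤code (∈-above⁺ ≤-refl ≼-refl))

  ∈-image⁺ : n ≤ m → n ≼ m → code (above n) ∈ image m
  ∈-image⁺ {m = m} n≤m n≼m = ∈-map⁺ (code ∘ above) (∈-filter⁺ (_≼? m) (∈-upTo⁺ (s≤s n≤m)) n≼m)

  ∈-image⁻ : k ∈ image m → ∃[ n ] n ≼ m × k ≡ code (above n)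
  ∈-image⁻ {m = m} k∈ =
    let n , n∈ , eq = ∈-map⁻ (code ∘ above) k∈ in n , proj₂ (∈-filter⁻ (_≼? m) n∈) , eq

  ≼⇒image-⊑ : m ≼ n → image m ⊑ image n
  ≼⇒image-⊑ {m} {n} m≼n = All.tabulate λ x∈ → divisor (∈-image⁻ x∈)
    where
    divisor : (∃[ w ] w ≼ m × k ≡ code (above w)) → Any (_∣ k) (image n)
    divisor (w , w≼m , refl) with ≤-total w n
    ... | inj₁ w≤n = lose (∈-image⁺ w≤n (≼-trans w≼m m≼n)) ∣-refl
    ... | inj₂ n≤w =
      lose (∈-image⁺ ≤-refl ≼-refl) (≤∧≼⇒code-above-∣ n≤w (≼-trans w≼m m≼n))

  -- It suffices to test the element that `m` itself contributes: a divisor of it coming from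
  -- `w ≼ n` forces `m ≼ w`.
  image-⊑⇒≼ : image m ⊑ image n → m ≼ n
  image-⊑⇒≼ {m} {n} m⊑n
    with y , y∈n , y∣m ← find (All.lookup m⊑n (∈-image⁺ ≤-refl ≼-refl))
    with w , w≼n , refl ← ∈-image⁻ y∈n
    = ≼-trans (code-above-∣⇒≼ y∣m) w≼n

-- Countability

-- Recursion on the witness: if 0 fails, the predicate is shifted down by one.
least : {P : Pred ℕ ℓ} → Decidable P → ∀ n → P n → ∃[ m ] P m × (∀ k → P k → m ≤ k)
least P? n pn with P? 0
least P? n pn | yes p0 = 0 , p0 , λ _ _ → z≤n
least P? zero p0 | no ¬p0 = contradiction p0 ¬p0
least {P = P} P? (suc n) pn | no ¬p0 with least (P? ∘ suc) n pn
... | m , pm , m≤ = suc m , pm , λ where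
  zero    p0 → contradiction p0 ¬p0
  (suc k) pk → s≤s (m≤ k pk)

lower-em : ∀ ℓ → ExcludedMiddle (c ⊔ ℓ) → ExcludedMiddle c
lower-em ℓ em = map′ lower (lift {ℓ = ℓ}) em

-- Allowing every list equivalent to `lengths G` makes the predicate invariant under homomorphic
-- equivalence, and so its least element too.
Codes : DiCycles → Pred ℕ _
Codes G n = ∃[ xs ] code xs ≡ n × SymInterior _⊑_ xs (lengths G)

Codes-resp-≈ : ∀ {G H} → Poset._≈_ DiCyclesOrder G H → Codes G n → Codes H n
Codes-resp-≈ {G = G} {H} G≈H (xs , eq , xs~G) = xs , eq , SymInterior.transitive ⊑-trans xs~G
  ( Equivalence.to (⟶⇔lengths-⊑ G H) (lhs≤rhs G≈H)
  , Equivalence.to (⟶⇔lengths-⊑ H G) (rhs≤lhs G≈H))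

-- Lists with equal codes have the same entries. The reverse homomorphism follows by exchanging `G`
-- and `H`.
Codes-injective : ∀ {G H} → Codes G n → Codes H n → proj₁ G ⟶ proj₁ H
Codes-injective {G = G} {H} (xs , refl , xs~G) (ys , eq , ys~H) =
  Equivalence.from (⟶⇔lengths-⊑ G H) (⊑-trans (rhs≤lhs xs~G) (⊑-trans
    (⊆⇒⊑ (Equivalence.to (code-∣⇔⊆ xs ys) (∣-reflexive (sym eq)))) (lhs≤rhs ys~H)))

DiCyclesOrder-countable : ExcludedMiddle _ → Countable DiCyclesOrder
DiCyclesOrder-countable em = record
  { to        = λ G → proj₁ (leastCode G)
  ; cong      = λ G≈H → ≤-antisym (leastCode-mono G≈H) (leastCode-mono (Eq.sym G≈H))
  ; injective = λ {G} {H} eq →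
      let codesG = proj₁ (proj₂ (leastCode G))
          codesH = subst (Codes H) (sym eq) (proj₁ (proj₂ (leastCode H)))
      in Codes-injective {G = G} {H} codesG codesH , Codes-injective {G = H} {G} codesH codesG
  }
  where
  open Poset DiCyclesOrder using (_≈_; module Eq)
  leastCode : ∀ G → ∃[ m ] Codes G m × (∀ k → Codes G k → m ≤ k)
  -- The code of `lengths G` itself starts the search; `em` decides the existential over lists.
  leastCode G = least (λ _ → em) (code (lengths G))
    (lengths G , refl , SymInterior.reflexive ⊑-refl)
  leastCode-mono : ∀ {G H} → G ≈ H → proj₁ (leastCode G) ≤ proj₁ (leastCode H)
  leastCode-mono {G} {H} G≈H = proj₂ (proj₂ (leastCode G)) _
    (Codes-resp-≈ {G = H} {G} (Eq.sym {G} {H} G≈H) (proj₁ (proj₂ (leastCode H))))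

-- Embedding a countable partial order

module _ (P : Poset c ℓ₁ ℓ₂) (countable : Countable P) where
  open Poset P using (Carrier) renaming (_≤_ to _≤ᴾ_)
  open Injection countable renaming (to to ι)

  -- Comparing principal down-sets makes ≼ a preorder on all of ℕ, including the
  -- numbers that ι does not attain.
  _≼_ : Rel ℕ (c ⊔ ℓ₂)
  i ≼ j = ∀ x → (∃[ a ] ι a ≡ i × x ≤ᴾ a) → ∃[ b ] ι b ≡ j × x ≤ᴾ b

  ≤⇒≼ : ∀ a b → a ≤ᴾ b → ι a ≼ ι b
  ≤⇒≼ a b a≤b x (a′ , ιa′≡ιa , x≤a′) =
    b , refl , Poset.trans P x≤a′ (Poset.trans P (Poset.reflexive P (injective ιa′≡ιa)) a≤b)

  ≼⇒≤ : ∀ a b → ι a ≼ ι b → a ≤ᴾ b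
  -- The inclusion of down-sets is tested at `a`, which lies in its own down-set.
  ≼⇒≤ a b a≼b with b′ , ιb′≡ιb , a≤b′ ← a≼b a (a , refl , Poset.refl P) =
    Poset.trans P a≤b′ (Poset.reflexive P (injective ιb′≡ιb))

  countable⇒embedding : ExcludedMiddle (c ⊔ ℓ₂) → Embedding P DiCyclesOrder
  countable⇒embedding em = graph ∘ ι , λ a b → mk⇔
    (λ a≤b → Equivalence.from (graph-⟶⇔⊑ (ι a) (ι b)) (≼⇒image-⊑ ≼-refl ≼-trans _≼?_ (≤⇒≼ a b a≤b)))
    (λ f → ≼⇒≤ a b (image-⊑⇒≼ ≼-refl ≼-trans _≼?_ (Equivalence.to (graph-⟶⇔⊑ (ι a) (ι b)) f)))
    where
    ≼-refl : Reflexive _≼_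
    ≼-refl _ = id
    ≼-trans : Transitive _≼_
    ≼-trans i≼j j≼k x = j≼k x ∘ i≼j x
    _≼?_ : B.Decidable _≼_
    _ ≼? _ = em
    sizes : ℕ → List ℕ
    sizes = image ≼-refl ≼-trans _≼?_
    graph : ℕ → DiCycles
    graph v = cycles (sizes v) (3≤image ≼-refl ≼-trans _≼?_ v)
    graph-⟶⇔⊑ : ∀ v w → proj₁ (graph v) ⟶ proj₁ (graph w) ⇔ sizes v ⊑ sizes w
    -- `lengths (graph v)` is `tabulate (lookup (sizes v))`, equal to `sizes v` only
    -- propositionally.
    graph-⟶⇔⊑ v w = subst₂ (λ xs ys → proj₁ (graph v) ⟶ proj₁ (graph w) ⇔ xs ⊑ ys)
      (tabulate-lookup (sizes v)) (tabulate-lookup (sizes w)) (⟶⇔lengths-⊑ (graph v) (graph w))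

theorem5p3p6 : ∀ {c ℓ₁ ℓ₂} → ExcludedMiddle (c ⊔ ℓ₁ ⊔ ℓ₂) → Universal c ℓ₁ ℓ₂ DiCyclesOrder
theorem5p3p6 {c} {ℓ₁} {ℓ₂} em =
  DiCyclesOrder-countable (lower-em (c ⊔ ℓ₁ ⊔ ℓ₂) em) ,
  λ P countable → countable⇒embedding P countable (lower-em {c = c ⊔ ℓ₂} ℓ₁ em)
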